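{- Assume the constraint theory $CT$ allows the built-in predicate $=$ and the signature contains at least a constant symbol and a function symbol of arity $>0$. Let $\mathcal{G}$ be a class of goals such that if $H$ is a head of a rule then $K\in\mathcal{G}$ for any $K\subseteq H$ (multiset inclusion). Then there exists no acceptable encoding, and no acceptable encoding for qualified answers, of $\mathrm{CHR}$ in $\mathrm{CHR}_1$ for the class $\mathcal{G}$.
   Context: **CHR.** Fix a signature whose predicate symbols are split into two disjoint sets $\Pi_b$ (built-in) and $\Pi_u$ (user-defined), and a first-order theory $CT$ giving the meaning of built-ins. Built-in constraints are given by $c::=a\mid c\wedge c\mid\exists_x c$ with $a$ an atomic formula over $\Pi_b$; a user-defined constraint is an atomic formula over $\Pi_u$. Conjunctions of atomic constraints are treated as multisets; "," denotes conjunction (multiset union); ${\tt true}$ is the empty multiset of built-in constraints. $Fv(\phi)$ is the set of free variables of $\phi$, and $\exists_{ -V}\phi$ is the existential closure of $\phi$ except for the variables in $V$. $p(\bar t)=p(\bar t')$ denotes the componentwise equalities $\bar t=\bar t'$ (undefined for different predicate symbols), extended in the expected way to multisets of constraints. A simplification rule has the form $H\Leftrightarrow C\mid B$ and a propagation rule the form $H\Rightarrow C\mid B$, where the head $H$ is a nonempty multiset of user-defined constraints, the guard $C$ a multiset of built-in constraints, and the body $B$ a multiset of constraints of both kinds. A program is a finite set of rules; a goal is a multiset of constraints of both kinds. Configurations are triples $\langle G,K,d\rangle$ ($G$ the constraints still to be solved, $K$ the accumulated user-defined constraints, $d$ a built-in constraint). For a program $P$, the relation $\longrightarrow$ is the least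 one such that: - Solve: $\langle (c,G),K,d\rangle\longrightarrow\langle G,K,d'\rangle$ if $c$ is built-in and $CT\models c\wedge d\leftrightarrow d'$; - Introduce: $\langle (h,G),K,d\rangle\longrightarrow\langle G,(h,K),d\rangle$ if $h$ is user-defined; - Simplify: $\langle G,H'\wedge K,d\rangle\longrightarrow\langle B\wedge G,K,H=H'\wedge d\rangle$ if $(H\Leftrightarrow C\mid B)\in P$, $x=Fv(H)$ and $CT\models d\rightarrow\exists_x((H=H')\wedge C)$; - Propagate: $\langle G,H'\wedge K,d\rangle\longrightarrow\langle B\wedge G,H'\wedge K,H=H'\wedge d\rangle$ if $(H\Rightarrow C\mid B)\in P$, $x=Fv(H)$ and $CT\models d\rightarrow\exists_x((H=H')\wedge C)$. In Simplify and Propagate the program rule is renamed with fresh variables. The data sufficient and qualified answers of $G$ in $P$ are $$\mathcal{SA}_P(G)=\{\exists_{ -Fv(G)}d\mid\langle G,\emptyset,\emptyset\rangle\longrightarrow^*\langle\emptyset,\emptyset,d\rangle\not\longrightarrow\},\quad \mathcal{QA}_P(G)=\{\exists_{ -Fv(G)}(K\wedge d)\mid \langle G,\emptyset,\emptyset\rangle\longrightarrow^*\langle\emptyset,K,d\rangle\not\longrightarrow\}.$$ Answers are read up to logical equivalence under $CT$ with respect to built-in constraints; multiplicity of user-defined constraints matters. **Dialects.** $\mathrm{CHR}$ is the full language (any number of atoms in heads); $\mathrm{CHR}_1$ is the language of programs whose rules have exactly one atom in the head. **Acceptable encodings.** For a CHR (sub)language $\mathrm{CHR}_x$ let $\mathcal{P}_x$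 be the set of its programs and $\mathcal{G}_x$ the set of its possible goals (the user-defined predicates of source and target languages may differ). An acceptable encoding of $\mathrm{CHR}_x$ into $\mathrm{CHR}_y$ for the class of goals $\mathcal{G}$ is a pair of mappings $[\![\ ]\!]:\mathcal{P}_x\to\mathcal{P}_y$ and $[\![\ ]\!]_g:\mathcal{G}_x\to\mathcal{G}_y$ such that: (1) $\mathcal{P}_x$ and $\mathcal{P}_y$ share the same $CT$; (2) for any goal $(A,B)\in\mathcal{G}_x$, $[\![A,B]\!]_g=[\![A]\!]_g,[\![B]\!]_g$, and the built-ins present in the goal are left unchanged; (3) for all $P\in\mathcal{P}_x$ and $G\in\mathcal{G}$, $\mathcal{SA}_P(G)=\mathcal{SA}_{[\![P]\!]}([\![G]\!]_g)$. An acceptable encoding for qualified answers is defined in the same way, with (3) replaced by: (3') for all $P\in\mathcal{P}_x$ and $G\in\mathcal{G}$, $\mathcal{QA}_P(G)=\mathcal{QA}_{[\![P]\!]}([\![G]\!]_g)$. -}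

module Defs where

open import Data.Bool using (if_then_else_)
open import Data.Empty using (⊥)
open import Data.List using (List; []; _∷_; _++_; [_]; map; concatMap; filter; foldr)
open import Data.List.Membership.Propositional using (_∈_; _∉_)
open import Data.List.NonEmpty as List⁺ using (List⁺)
open import Data.List.Relation.Binary.Permutation.Homogeneous using (Permutation)
open import Data.List.Relation.Binary.Permutation.Propositional using (_↭_)
open import Data.List.Relation.Binary.Pointwise using (Pointwise; []; _∷_)
open import Data.List.Relation.Unary.All using (All)
open import Data.Nat using (ℕ; _≟_)
open import Data.Product using (Σ; ∃; ∃₂; _×_; _,_; proj₁)
open import Data.Unit using (⊤)
open import Data.Vec as Vec using (Vec; []; _∷_)
import Data.List.Membership.DecPropositional as DecMembership
import Data.Vec.Relation.Binary.Pointwise.Inductive as VecPointwise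
open import Function.Definitions using (Injective)
open import Level using (Level; 0ℓ; _⊔_; suc)
open import Relation.Binary.Bundles using (Setoid)
open import Relation.Binary.Construct.Closure.ReflexiveTransitive using (Star)
open import Relation.Binary.PropositionalEquality using (_≡_)
open import Relation.Nullary using (¬_; does; ¬?)
open import Relation.Unary using (Pred; U)

Var : Set
Var = ℕ

open DecMembership _≟_ using (_∈?_)

_∖_ : List Var → List Var → List Var
xs ∖ ys = filter (λ x → ¬? (x ∈? ys)) xs

-- Equality is not listed in Πᵇ: it is a logical symbol, available as a
-- built-in predicate in every signature (see _≐_ below).
record Signature : Set₁ where
  field
    Fun    : Set
    arity  : Fun → ℕ
    Πᵇ     : Set
    arityᵇ : Πᵇ → ℕ
    Πᵘ     : Set
    arityᵘ : Πᵘ → ℕ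

module Logic (Sg : Signature) where
  open Signature Sg

  data Term : Set where
    var : Var → Term
    fun : (f : Fun) → Vec Term (arity f) → Term

  mutual
    fvᵗ : Term → List Var
    fvᵗ (var x)    = [ x ]
    fvᵗ (fun f ts) = fvᵗˢ ts

    fvᵗˢ : ∀ {n} → Vec Term n → List Var
    fvᵗˢ []       = []
    fvᵗˢ (t ∷ ts) = fvᵗ t ++ fvᵗˢ ts

  mutual
    renameᵗ : (Var → Var) → Term → Term
    renameᵗ ρ (var x)    = var (ρ x)
    renameᵗ ρ (fun f ts) = fun f (renameᵗˢ ρ ts)

    renameᵗˢ : ∀ {n} → (Var → Var) → Vec Term n → Vec Term n
    renameᵗˢ ρ []       = []
    renameᵗˢ ρ (t ∷ ts) = renameᵗ ρ t ∷ renameᵗˢ ρ ts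

  infix  8 _≐_
  infixr 7 _∧_

  data BuiltIn : Set where
    true : BuiltIn
    atom : (R : Πᵇ) → Vec Term (arityᵇ R) → BuiltIn
    _≐_  : Term → Term → BuiltIn
    _∧_  : BuiltIn → BuiltIn → BuiltIn
    ∃ᵇ   : Var → BuiltIn → BuiltIn

  fvᵇ : BuiltIn → List Var
  fvᵇ true        = []
  fvᵇ (atom R ts) = fvᵗˢ ts
  fvᵇ (s ≐ t)     = fvᵗ s ++ fvᵗ t
  fvᵇ (c ∧ d)     = fvᵇ c ++ fvᵇ d
  fvᵇ (∃ᵇ x c)    = fvᵇ c ∖ [ x ]

  -- Bound variables are renamed as well; this is capture-free because it is
  -- only used with injective ρ.
  renameᵇ : (Var → Var) → BuiltIn → BuiltIn
  renameᵇ ρ true        = true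
  renameᵇ ρ (atom R ts) = atom R (renameᵗˢ ρ ts)
  renameᵇ ρ (s ≐ t)     = renameᵗ ρ s ≐ renameᵗ ρ t
  renameᵇ ρ (c ∧ d)     = renameᵇ ρ c ∧ renameᵇ ρ d
  renameᵇ ρ (∃ᵇ x c)    = ∃ᵇ (ρ x) (renameᵇ ρ c)

  ⋀ : List BuiltIn → BuiltIn
  ⋀ = foldr _∧_ true

  ∃⋆ : List Var → BuiltIn → BuiltIn
  ∃⋆ xs c = foldr ∃ᵇ c xs

  infixr 6 _and_
  infixr 5 _or_
  infixr 4 _implies_
  infix  3 _iff_

  data Formula : Set where
    ⌈_⌉              : BuiltIn → Formula
    false            : Formula
    _and_ _or_       : Formula → Formula → Formula
    _implies_        : Formula → Formula → Formula
    forall′ exists′  : Var → Formula → Formula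

  _iff_ : Formula → Formula → Formula
  φ iff ψ = (φ implies ψ) and (ψ implies φ)

  -- Equality is interpreted by the equality of the carrier setoid.  Relations
  -- are ¬¬-stable, so that together with the clauses for _or_ and the
  -- existentials below, satisfaction is that of classical logic.
  record Structure : Set₁ where
    field
      domain : Setoid 0ℓ 0ℓ
    open Setoid domain public using (Carrier; _≈_)
    _≋_ : ∀ {n} → Vec Carrier n → Vec Carrier n → Set
    _≋_ = VecPointwise.Pointwise _≈_
    field
      point    : Carrier
      ≈-stable : ∀ {a b} → ¬ ¬ (a ≈ b) → a ≈ b
      ⟦_⟧ᶠ     : (f : Fun) → Vec Carrier (arity f) → Carrier
      ⟦⟧ᶠ-cong : ∀ f {as bs} → as ≋ bs → ⟦ f ⟧ᶠ as ≈ ⟦ f ⟧ᶠ bs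
      ⟦_⟧ʳ     : (R : Πᵇ) → Vec Carrier (arityᵇ R) → Set
      ⟦⟧ʳ-resp : ∀ R {as bs} → as ≋ bs → ⟦ R ⟧ʳ as → ⟦ R ⟧ʳ bs
      ⟦⟧ʳ-stable : ∀ R {as} → ¬ ¬ ⟦ R ⟧ʳ as → ⟦ R ⟧ʳ as

  module _ (M : Structure) where
    open Structure M

    Assignment : Set
    Assignment = Var → Carrier

    _[_↦_] : Assignment → Var → Carrier → Assignment
    (v [ x ↦ a ]) y = if does (y ≟ x) then a else v y

    mutual
      eval : Assignment → Term → Carrier
      eval v (var x)    = v x
      eval v (fun f ts) = ⟦ f ⟧ᶠ (evals v ts)

      evals : ∀ {n} → Assignment → Vec Term n → Vec Carrier n
      evals v []       = []
      evals v (t ∷ ts) = eval v t ∷ evals v ts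

    Satᵇ : Assignment → BuiltIn → Set
    Satᵇ v true        = ⊤
    Satᵇ v (atom R ts) = ⟦ R ⟧ʳ (evals v ts)
    Satᵇ v (s ≐ t)     = eval v s ≈ eval v t
    Satᵇ v (c ∧ d)     = Satᵇ v c × Satᵇ v d
    Satᵇ v (∃ᵇ x c)    = ¬ (∀ a → ¬ Satᵇ (v [ x ↦ a ]) c)

    Sat : Assignment → Formula → Set
    Sat v ⌈ c ⌉         = Satᵇ v c
    Sat v false         = ⊥
    Sat v (φ and ψ)     = Sat v φ × Sat v ψ
    Sat v (φ or ψ)      = ¬ (¬ Sat v φ × ¬ Sat v ψ)
    Sat v (φ implies ψ) = Sat v φ → Sat v ψ
    Sat v (forall′ x φ) = ∀ a → Sat (v [ x ↦ a ]) φ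
    Sat v (exists′ x φ) = ¬ (∀ a → ¬ Sat (v [ x ↦ a ]) φ)

    Valid : Formula → Set
    Valid φ = ∀ v → Sat v φ

  -- Axioms with free variables are read as universally closed.
  Theory : Set₁
  Theory = Pred Formula 0ℓ

  IsModel : Theory → Structure → Set
  IsModel CT M = ∀ {φ} → CT φ → Valid M φ

  infix 2 _⊨_
  _⊨_ : Theory → Formula → Set₁
  CT ⊨ φ = ∀ M → IsModel CT M → Valid M φ

  -- The user-defined predicates of one particular CHR language: a subset of
  -- Πᵘ.  Different languages may use different subsets.
  record Vocabulary : Set₁ where
    field
      Symbol         : Set
      name           : Symbol → Πᵘ
      name-injective : Injective _≡_ _≡_ name
  open Vocabulary public

  data Atom (Π : Vocabulary) : Set where
    _$_ : (p : Symbol Π) → Vec Term (arityᵘ (name Π p)) → Atom Π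

  data Constraint (Π : Vocabulary) : Set where
    builtin : BuiltIn → Constraint Π
    user    : Atom Π → Constraint Π

  -- Lists stand for multisets: they are only ever compared up to _↭_.
  Goal : Vocabulary → Set
  Goal Π = List (Constraint Π)

  data Kind : Set where
    simplification propagation : Kind

  record Rule (Π : Vocabulary) : Set where
    constructor mkRule
    field
      kind  : Kind
      head  : List⁺ (Atom Π)
      guard : List BuiltIn
      body  : Goal Π
  open Rule public

  headᵐ : ∀ {Π} → Rule Π → List (Atom Π)
  headᵐ r = List⁺.toList (head r)

  module _ {Π : Vocabulary} where

    fvᵃ : Atom Π → List Var
    fvᵃ (p $ ts) = fvᵗˢ ts

    fvᵃˢ : List (Atom Π) → List Var
    fvᵃˢ = concatMap fvᵃ

    fvᶜ : Constraint Π → List Var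
    fvᶜ (builtin c) = fvᵇ c
    fvᶜ (user h)    = fvᵃ h

    fvᵍ : Goal Π → List Var
    fvᵍ = concatMap fvᶜ

    fvʳ : Rule Π → List Var
    fvʳ r = fvᵃˢ (headᵐ r) ++ concatMap fvᵇ (guard r) ++ fvᵍ (body r)

    renameᵃ : (Var → Var) → Atom Π → Atom Π
    renameᵃ ρ (p $ ts) = p $ renameᵗˢ ρ ts

    renameᶜ : (Var → Var) → Constraint Π → Constraint Π
    renameᶜ ρ (builtin c) = builtin (renameᵇ ρ c)
    renameᶜ ρ (user h)    = user (renameᵃ ρ h)

    renameʳ : (Var → Var) → Rule Π → Rule Π
    renameʳ ρ (mkRule k H C B) =
      mkRule k (List⁺.map (renameᵃ ρ) H) (map (renameᵇ ρ) C) (map (renameᶜ ρ) B)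

    -- The equations between two multisets of atoms, H = H′, exist only when
    -- corresponding atoms have the same predicate symbol.
    data _~_ : Atom Π → Atom Π → Set where
      same : ∀ p ts us → (p $ ts) ~ (p $ us)

    equationᵃ : ∀ {h h′} → h ~ h′ → BuiltIn
    equationᵃ (same p ts us) = ⋀ (Vec.toList (Vec.zipWith _≐_ ts us))

    equations : ∀ {H H′} → Pointwise _~_ H H′ → BuiltIn
    equations []       = true
    equations (e ∷ es) = equationᵃ e ∧ equations es

  Program′ : Vocabulary → Set
  Program′ Π = List (Rule Π)

  -- A CHR (sub)language: a vocabulary and the rules it admits.
  record Language : Set₁ where
    field
      vocabulary : Vocabulary
      admits     : Pred (Rule vocabulary) 0ℓ
  open Language public

  Program : Language → Set
  Program L = Σ (Program′ (vocabulary L)) (All (admits L))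

  Goals : Language → Set
  Goals L = Goal (vocabulary L)

  CHR : Vocabulary → Language
  CHR Π = record { vocabulary = Π ; admits = U }

  CHR₁ : Vocabulary → Language
  CHR₁ Π = record { vocabulary = Π ; admits = λ r → List⁺.length (head r) ≡ 1 }

  -- "If H is a head of a rule then K ∈ 𝒢 for any K ⊆ H", for the rules of L.
  ContainsSubheads : ∀ {ℓ} (L : Language) → Pred (Goals L) ℓ → Set ℓ
  ContainsSubheads L 𝒢 =
    ∀ r → admits L r → ∀ K K′ → headᵐ r ↭ K ++ K′ → 𝒢 (map user K)

  record Config (Π : Vocabulary) : Set where
    constructor ⟨_,_,_⟩
    field
      goal  : Goal Π
      store : List (Atom Π)
      built : BuiltIn

  fvᶜᶠ : ∀ {Π} → Config Π → List Var
  fvᶜᶠ ⟨ G , K , d ⟩ = fvᵍ G ++ fvᵃˢ K ++ fvᵇ d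

  -- r′ is a variant of r whose variables avoid V.
  FreshVariant : ∀ {Π} → List Var → Rule Π → Rule Π → Set
  FreshVariant V r r′ =
    ∃ λ ρ → Injective _≡_ _≡_ ρ × r′ ≡ renameʳ ρ r × (∀ {x} → x ∈ fvʳ r′ → x ∉ V)

  module Semantics (CT : Theory) where

    Applicable : ∀ {Π} (r : Rule Π) {H′ : List (Atom Π)} →
                 Pointwise _~_ (headᵐ r) H′ → BuiltIn → Set₁
    Applicable r H=H′ d =
      CT ⊨ ⌈ d ⌉ implies ⌈ ∃⋆ (fvᵃˢ (headᵐ r)) (equations H=H′ ∧ ⋀ (guard r)) ⌉

    -- One transition, the rule being renamed apart from V.
    data Step {Π : Vocabulary} (P : Program′ Π) (V : List Var) : Config Π → Config Π → Set₁ where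

      solve : ∀ {G G′ K d d′} c →
        G ↭ builtin c ∷ G′ →
        CT ⊨ ⌈ c ∧ d ⌉ iff ⌈ d′ ⌉ →
        Step P V ⟨ G , K , d ⟩ ⟨ G′ , K , d′ ⟩

      introduce : ∀ {G G′ K d} h →
        G ↭ user h ∷ G′ →
        Step P V ⟨ G , K , d ⟩ ⟨ G′ , h ∷ K , d ⟩

      simplify : ∀ {G K K′ H′ d r r′} →
        r ∈ P → kind r ≡ simplification → FreshVariant V r r′ →
        K ↭ H′ ++ K′ →
        (H=H′ : Pointwise _~_ (headᵐ r′) H′) → Applicable r′ H=H′ d →
        Step P V ⟨ G , K , d ⟩ ⟨ body r′ ++ G , K′ , equations H=H′ ∧ d ⟩

      propagate : ∀ {G K K′ H′ d r r′} →
        r ∈ P → kind r ≡ propagation → FreshVariant V r r′ →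
        K ↭ H′ ++ K′ →
        (H=H′ : Pointwise _~_ (headᵐ r′) H′) → Applicable r′ H=H′ d →
        Step P V ⟨ G , K , d ⟩ ⟨ body r′ ++ G , H′ ++ K′ , equations H=H′ ∧ d ⟩

    -- A configuration together with all variables that have occurred so far in
    -- the derivation (in particular those of the initial goal); fresh variables
    -- are fresh with respect to these.
    State : Vocabulary → Set
    State Π = List Var × Config Π

    data _⊢_⟶_ {Π : Vocabulary} (P : Program′ Π) : State Π → State Π → Set₁ where
      step : ∀ {V γ γ′} → Step P V γ γ′ → P ⊢ (V , γ) ⟶ (V ++ fvᶜᶠ γ′ , γ′)

    _⊢_⟶⋆_ : ∀ {Π} → Program′ Π → State Π → State Π → Set₁
    P ⊢ s ⟶⋆ s′ = Star (P ⊢_⟶_) s s′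

    _⊢_̸⟶ : ∀ {Π} → Program′ Π → State Π → Set₁
    P ⊢ s ̸⟶ = ∀ s′ → ¬ (P ⊢ s ⟶ s′)

    start : ∀ {Π} → Goal Π → State Π
    start G = fvᵍ G , ⟨ G , [] , true ⟩

    FinalConfig : ∀ {Π} → Program′ Π → Goal Π → List (Atom Π) → BuiltIn → Set₁
    FinalConfig P G K d = ∃ λ V →
      P ⊢ start G ⟶⋆ (V , ⟨ [] , K , d ⟩) × P ⊢ (V , ⟨ [] , K , d ⟩) ̸⟶

    SA : ∀ {Π} → Program′ Π → Goal Π → Pred BuiltIn (suc 0ℓ)
    SA P G c = ∃ λ d → FinalConfig P G [] d × c ≡ ∃⋆ (fvᵇ d ∖ fvᵍ G) d

    -- The formula ∃ bound (atoms ∧ constr).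
    record Qualified (Π : Vocabulary) : Set where
      constructor ∃[_]_&_
      field
        bound  : List Var
        atoms  : List (Atom Π)
        constr : BuiltIn
    open Qualified public

    QA : ∀ {Π} → Program′ Π → Goal Π → Pred (Qualified Π) (suc 0ℓ)
    QA P G q = ∃₂ λ K d → FinalConfig P G K d ×
      q ≡ ∃[ (fvᵃˢ K ++ fvᵇ d) ∖ fvᵍ G ] K & d

    module _ (M : Structure) where
      open Structure M

      GroundAtom : Set
      GroundAtom = Σ Πᵘ λ p → Vec Carrier (arityᵘ p)

      data _≈ᵃ_ : GroundAtom → GroundAtom → Set where
        same : ∀ {p as bs} → as ≋ bs → (p , as) ≈ᵃ (p , bs)

      ground : ∀ {Π} → Assignment M → Atom Π → GroundAtom
      ground {Π} v (p $ ts) = name Π p , evals M v ts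

      AgreeOff : List Var → Assignment M → Assignment M → Set
      AgreeOff xs v w = ∀ x → x ∉ xs → w x ≡ v x

      -- In M, under the assignment v of its free variables, q denotes the
      -- multisets of ground user-defined atoms that arise from the values of
      -- its bound variables satisfying the built-in part.  Every multiset
      -- denoted by q is (classically) denoted by q′:
      Entailsᵠ : ∀ {Π Π′} → Assignment M → Qualified Π → Qualified Π′ → Set
      Entailsᵠ v q q′ = ∀ w → AgreeOff (bound q) v w → Satᵇ M w (constr q) →
        ¬ ¬ (∃ λ w′ → AgreeOff (bound q′) v w′ × Satᵇ M w′ (constr q′) ×
               Permutation _≈ᵃ_ (map (ground w) (atoms q)) (map (ground w′) (atoms q′)))

    -- Logical equivalence under CT as regards built-ins, with user-defined
    -- atoms counted with multiplicity.
    _≈ᵠ_ : ∀ {Π Π′} → Qualified Π → Qualified Π′ → Set₁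
    q ≈ᵠ q′ = ∀ M → IsModel CT M → ∀ v → Entailsᵠ M v q q′ × Entailsᵠ M v q′ q

    _≈ᵇ_ : BuiltIn → BuiltIn → Set₁
    c ≈ᵇ c′ = CT ⊨ ⌈ c ⌉ iff ⌈ c′ ⌉

    EqualUpTo : ∀ {A B : Set} → (A → B → Set₁) → Pred A (suc 0ℓ) → Pred B (suc 0ℓ) → Set₁
    EqualUpTo _≈_ S T =
      (∀ x → S x → ∃ λ y → T y × x ≈ y) × (∀ y → T y → ∃ λ x → S x × x ≈ y)

    record Encoding (X Y : Language) : Set where
      field
        ⟦_⟧          : Program X → Program Y
        ⟦_⟧ᵍ         : Goals X → Goals Y
        ⟦⟧ᵍ-cong     : ∀ {A B} → A ↭ B → ⟦ A ⟧ᵍ ↭ ⟦ B ⟧ᵍ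
        ⟦⟧ᵍ-++       : ∀ A B → ⟦ A ++ B ⟧ᵍ ↭ ⟦ A ⟧ᵍ ++ ⟦ B ⟧ᵍ
        ⟦⟧ᵍ-builtin  : ∀ c → ⟦ [ builtin c ] ⟧ᵍ ↭ [ builtin c ]

    record AcceptableEncoding {ℓ} (X Y : Language) (𝒢 : Pred (Goals X) ℓ) : Set (suc 0ℓ ⊔ ℓ) where
      field
        encoding : Encoding X Y
      open Encoding encoding public
      field
        SA-preserved : ∀ (P : Program X) G → 𝒢 G →
          EqualUpTo _≈ᵇ_ (SA (proj₁ P) G) (SA (proj₁ ⟦ P ⟧) ⟦ G ⟧ᵍ)

    record AcceptableEncodingQA {ℓ} (X Y : Language) (𝒢 : Pred (Goals X) ℓ) : Set (suc 0ℓ ⊔ ℓ) where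
      field
        encoding : Encoding X Y
      open Encoding encoding public
      field
        QA-preserved : ∀ (P : Program X) G → 𝒢 G →
          EqualUpTo _≈ᵠ_ (QA (proj₁ P) G) (QA (proj₁ ⟦ P ⟧) ⟦ G ⟧ᵍ)

{-# OPTIONS --safe #-}
module Submission where

-- Take a closed atom a and the program with the rules a ⇒ true and a, a ⇔ true.
-- The goal a has no answer, because the propagation rule stays applicable for
-- ever, whereas a, a has the answer true.  In a translation g, g of a, a every
-- step rewrites a constraint descending from just one of the two copies of g,
-- so only the built-in store lets the copies interact.  As the final store is
-- solvable for all values of the goal's variables, and the copies introduce
-- disjoint sets of fresh variables, the constraints contributed by the second
-- copy can be dropped from the premise of every guard met by the first.  So g
-- alone reaches a configuration with empty goal.  That configuration is final
-- if the store is empty, as it is if CT has a model; if CT has no model, all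
-- guards hold, and a rule applicable to the store of g would be applicable to
-- the store of g, g.  Hence g has an answer, but a has none.

open import Defs
open import Data.Bool as Bool using (if_then_else_)
open import Data.Empty using (⊥; ⊥-elim)
open import Data.List using (List; []; _∷_; _++_; [_]; map; concatMap)
open import Data.List.Extrema.Nat using (max; xs≤max)
import Data.List.Membership.DecPropositional as DecMembership
open import Data.List.Membership.Propositional using (_∈_; _∉_)
open import Data.List.Membership.Propositional.Properties
  using (∈-++⁺ˡ; ∈-++⁺ʳ; ∈-++⁻; ∈-∃++; ∈-filter⁺; ∈-filter⁻)
open import Data.List.NonEmpty as List⁺ using (List⁺; _∷_)
import Data.List.Properties as List
open import Data.List.Relation.Binary.Permutation.Homogeneous using (Permutation; refl; trans)
open import Data.List.Relation.Binary.Permutation.Propositional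
  using (_↭_; ↭-refl; ↭-sym; ↭-trans; prep)
open import Data.List.Relation.Binary.Permutation.Propositional.Properties
  using (∈-resp-↭; drop-∷; shift; ++⁺ˡ; ++⁺ʳ; ++-comm; ++-assoc; ↭-empty-inv; ↭-singleton-inv; ¬x∷xs↭[]; ↭-length)
open import Data.List.Relation.Binary.Pointwise using (Pointwise; []; _∷_)
open import Data.List.Relation.Binary.Subset.Propositional using (_⊆_)
open import Data.List.Relation.Binary.Subset.Propositional.Properties
  using (concatMap⁺; xs⊆xs++ys; xs⊆ys++xs)
open import Data.List.Relation.Unary.All as All using (All; []; _∷_)
open import Data.List.Relation.Unary.Any using (here; there)
open import Data.Nat using (ℕ; _+_; _>_; _≟_; _≡ᵇ_)
open import Data.Nat.Properties using (≡ᵇ⇒≡; ≡⇒≡ᵇ; +-cancelˡ-≡; <⇒≱; m≤m+n)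
open import Data.Product using (∃; _×_; swap; _,_; proj₁; proj₂)
open import Data.Sum as Sum using (_⊎_; inj₁; inj₂; [_,_]′)
open import Data.Unit using (tt)
open import Data.Vec as Vec using (Vec; []; _∷_)
open import Function using (_∘_; id; case_of_)
open import Relation.Binary.Bundles using (Setoid)
open import Relation.Binary.Construct.Closure.ReflexiveTransitive using (ε; _◅_)
open import Relation.Binary.PropositionalEquality as ≡ using (_≡_; refl; cong; cong₂; subst)
open import Relation.Nullary using (¬_; does; yes; no; ¬?; _×-dec_)
open import Relation.Nullary.Decidable using (dec-true; dec-false)
open import Relation.Unary using (Pred)
open DecMembership _≟_ using (_∈?_)

-- Membership in list differences and multisets

∈-∖⁺ : ∀ {x xs ys} → x ∈ xs → x ∉ ys → x ∈ xs ∖ ys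
∈-∖⁺ {ys = ys} = ∈-filter⁺ (λ x → ¬? (x ∈? ys))

∈-∖⁻ : ∀ {x} xs ys → x ∈ xs ∖ ys → x ∈ xs × x ∉ ys
∈-∖⁻ xs ys = ∈-filter⁻ (λ x → ¬? (x ∈? ys)) {xs = xs}

Permutation-empty-inv : ∀ {a r} {A : Set a} {R : A → A → Set r} {xs} →
  Permutation R [] xs → xs ≡ []
Permutation-empty-inv (refl [])   = refl
Permutation-empty-inv (trans p q) with refl ← Permutation-empty-inv p = Permutation-empty-inv q

-- Lets the part of a configuration that owns the selected constraint remove it without touching the
-- other part.
∈-++-extract : ∀ {A : Set} {x : A} {xs ys zs} → x ∈ xs → xs ++ ys ↭ x ∷ zs →
  ∃ λ xs′ → xs ↭ x ∷ xs′ × zs ↭ xs′ ++ ys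
∈-++-extract {x = x} {ys = ys} x∈xs p with as , bs , refl ← ∈-∃++ x∈xs =
  as ++ bs , shift x as bs ,
  drop-∷ (↭-trans (↭-sym p) (++⁺ʳ ys (shift x as bs)))

module _ (Sg : Signature) where
  open Signature Sg
  open Logic Sg

  -- Free variables and renaming

  mutual
    rename-closedᵗ : ∀ ρ t → fvᵗ t ≡ [] → renameᵗ ρ t ≡ t
    rename-closedᵗ ρ (fun f ts) e = cong (fun f) (rename-closedᵗˢ ρ ts e)

    rename-closedᵗˢ : ∀ {n} ρ (ts : Vec Term n) → fvᵗˢ ts ≡ [] → renameᵗˢ ρ ts ≡ ts
    rename-closedᵗˢ ρ []       e = refl
    rename-closedᵗˢ ρ (t ∷ ts) e = cong₂ _∷_
      (rename-closedᵗ ρ t (List.++-conicalˡ (fvᵗ t) _ e))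
      (rename-closedᵗˢ ρ ts (List.++-conicalʳ (fvᵗ t) _ e))

  fvᵗˢ-replicate : ∀ n {t} → fvᵗ t ≡ [] → fvᵗˢ (Vec.replicate n t) ≡ []
  fvᵗˢ-replicate ℕ.zero    e = refl
  fvᵗˢ-replicate (ℕ.suc n) e = cong₂ _++_ e (fvᵗˢ-replicate n e)

  mutual
    fv-renameᵗ : ∀ ρ t {x} → x ∈ fvᵗ (renameᵗ ρ t) → ∃ λ y → x ≡ ρ y
    fv-renameᵗ ρ (var y) (here e) = y , e
    fv-renameᵗ ρ (fun f ts)       = fv-renameᵗˢ ρ ts

    fv-renameᵗˢ : ∀ {n} ρ (ts : Vec Term n) {x} → x ∈ fvᵗˢ (renameᵗˢ ρ ts) → ∃ λ y → x ≡ ρ y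
    fv-renameᵗˢ ρ (t ∷ ts) = [ fv-renameᵗ ρ t , fv-renameᵗˢ ρ ts ]′ ∘ ∈-++⁻ (fvᵗ (renameᵗ ρ t))

  fv-renameᵇ : ∀ ρ c {x} → x ∈ fvᵇ (renameᵇ ρ c) → ∃ λ y → x ≡ ρ y
  fv-renameᵇ ρ (atom R ts) = fv-renameᵗˢ ρ ts
  fv-renameᵇ ρ (s ≐ t)     = [ fv-renameᵗ ρ s , fv-renameᵗ ρ t ]′ ∘ ∈-++⁻ (fvᵗ (renameᵗ ρ s))
  fv-renameᵇ ρ (c ∧ d)     = [ fv-renameᵇ ρ c , fv-renameᵇ ρ d ]′ ∘ ∈-++⁻ (fvᵇ (renameᵇ ρ c))
  fv-renameᵇ ρ (∃ᵇ y c)    = fv-renameᵇ ρ c ∘ proj₁ ∘ ∈-∖⁻ (fvᵇ (renameᵇ ρ c)) [ ρ y ]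

  fv-concatMap-rename : ∀ {A : Set} {fv : A → List Var} {ren : A → A} {ρ : Var → Var} →
    (∀ a {x} → x ∈ fv (ren a) → ∃ λ y → x ≡ ρ y) →
    ∀ as {x} → x ∈ concatMap fv (map ren as) → ∃ λ y → x ≡ ρ y
  fv-concatMap-rename {fv = fv} {ren} h (a ∷ as) =
    [ h a , fv-concatMap-rename h as ]′ ∘ ∈-++⁻ (fv (ren a))

  module _ {Π : Vocabulary} where

    fv-renameᵃ : ∀ ρ (h : Atom Π) {x} → x ∈ fvᵃ (renameᵃ ρ h) → ∃ λ y → x ≡ ρ y
    fv-renameᵃ ρ (p $ ts) = fv-renameᵗˢ ρ ts

    fv-renameᶜ : ∀ ρ (c : Constraint Π) {x} → x ∈ fvᶜ (renameᶜ ρ c) → ∃ λ y → x ≡ ρ y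
    fv-renameᶜ ρ (builtin c) = fv-renameᵇ ρ c
    fv-renameᶜ ρ (user h)    = fv-renameᵃ ρ h

    fv-renameʳ : ∀ ρ (r : Rule Π) {x} → x ∈ fvʳ (renameʳ ρ r) → ∃ λ y → x ≡ ρ y
    fv-renameʳ ρ (mkRule _ (h ∷ H) C B) =
      [ fv-concatMap-rename (fv-renameᵃ ρ) (h ∷ H)
      , [ fv-concatMap-rename (fv-renameᵇ ρ) C , fv-concatMap-rename (fv-renameᶜ ρ) B ]′
        ∘ ∈-++⁻ (concatMap fvᵇ (map (renameᵇ ρ) C))
      ]′ ∘ ∈-++⁻ (fvᵃˢ (map (renameᵃ ρ) (h ∷ H)))

    fvᵍ-++⁺ˡ : ∀ (G : Goal Π) {G′} → fvᵍ G ⊆ fvᵍ (G ++ G′)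
    fvᵍ-++⁺ˡ G = concatMap⁺ fvᶜ (xs⊆xs++ys G _)

    fvᵍ-++⁻ : ∀ (G : Goal Π) {G′ x} → x ∈ fvᵍ (G ++ G′) → x ∈ fvᵍ G ⊎ x ∈ fvᵍ G′
    fvᵍ-++⁻ G {G′} = ∈-++⁻ (fvᵍ G) ∘ subst (_ ∈_) (List.concatMap-++ fvᶜ G G′)

    fv-zipWith-≐ : ∀ {n} (ts us : Vec Term n) →
      fvᵇ (⋀ (Vec.toList (Vec.zipWith _≐_ ts us))) ⊆ fvᵗˢ ts ++ fvᵗˢ us
    fv-zipWith-≐ []       []       ()
    fv-zipWith-≐ (t ∷ ts) (u ∷ us) x∈ with ∈-++⁻ (fvᵗ t ++ fvᵗ u) x∈
    ... | inj₁ x∈tu with ∈-++⁻ (fvᵗ t) x∈tu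
    ...   | inj₁ x∈t = ∈-++⁺ˡ (∈-++⁺ˡ x∈t)
    ...   | inj₂ x∈u = ∈-++⁺ʳ (fvᵗˢ (t ∷ ts)) (∈-++⁺ˡ x∈u)
    fv-zipWith-≐ (t ∷ ts) (u ∷ us) x∈ | inj₂ x∈′ with ∈-++⁻ (fvᵗˢ ts) (fv-zipWith-≐ ts us x∈′)
    ...   | inj₁ x∈ts = ∈-++⁺ˡ (∈-++⁺ʳ (fvᵗ t) x∈ts)
    ...   | inj₂ x∈us = ∈-++⁺ʳ (fvᵗˢ (t ∷ ts)) (∈-++⁺ʳ (fvᵗ u) x∈us)

    fv-equationᵃ : ∀ {h h′ : Atom Π} (e : h ~ h′) → fvᵇ (equationᵃ e) ⊆ fvᵃ h ++ fvᵃ h′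
    fv-equationᵃ (same p ts us) = fv-zipWith-≐ ts us

    fv-equations : ∀ {H H′ : List (Atom Π)} (es : Pointwise _~_ H H′) {x} →
      x ∈ fvᵇ (equations es) → x ∈ fvᵃˢ H ⊎ x ∈ fvᵃˢ H′
    fv-equations {h ∷ H} {h′ ∷ H′} (e ∷ es) x∈ with ∈-++⁻ (fvᵇ (equationᵃ e)) x∈
    ... | inj₂ x∈es = [ inj₁ ∘ ∈-++⁺ʳ (fvᵃ h) , inj₂ ∘ ∈-++⁺ʳ (fvᵃ h′) ]′ (fv-equations es x∈es)
    ... | inj₁ x∈e  = [ inj₁ ∘ ∈-++⁺ˡ , inj₂ ∘ ∈-++⁺ˡ ]′ (∈-++⁻ (fvᵃ h) (fv-equationᵃ e x∈e))

    -- Matching depends on predicate symbols only, so one variant of a head can be exchanged for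
    -- another.
    ~-rename : ∀ {ρ} τ H {H′ : List (Atom Π)} →
      Pointwise _~_ (map (renameᵃ ρ) H) H′ → Pointwise _~_ (map (renameᵃ τ) H) H′
    ~-rename τ []             []                    = []
    ~-rename τ ((p $ ts) ∷ H) (same .p _ us ∷ es) = same p _ us ∷ ~-rename τ H es

  fv-⋀ : ∀ cs → fvᵇ (⋀ cs) ⊆ concatMap fvᵇ cs
  fv-⋀ (c ∷ cs) x∈ with ∈-++⁻ (fvᵇ c) x∈
  ... | inj₁ x∈c  = ∈-++⁺ˡ x∈c
  ... | inj₂ x∈cs = ∈-++⁺ʳ (fvᵇ c) (fv-⋀ cs x∈cs)

  fv-∃⋆ : ∀ xs c → fvᵇ (∃⋆ xs c) ⊆ fvᵇ c
  fv-∃⋆ []       c = id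
  fv-∃⋆ (x ∷ xs) c = fv-∃⋆ xs c ∘ proj₁ ∘ ∈-∖⁻ (fvᵇ (∃⋆ xs c)) [ x ]

  -- Satisfaction in a structure

  module _ (M : Structure) where
    open Structure M

    private
      _⟨_≔_⟩ : Assignment M → Var → Carrier → Assignment M
      _⟨_≔_⟩ = _[_↦_] M

    mutual
      eval-cong : ∀ {v w} t → (∀ {x} → x ∈ fvᵗ t → v x ≡ w x) → eval M v t ≡ eval M w t
      eval-cong (var x)    v≗w = v≗w (here refl)
      eval-cong (fun f ts) v≗w = cong ⟦ f ⟧ᶠ (evals-cong ts v≗w)

      evals-cong : ∀ {n v w} (ts : Vec Term n) → (∀ {x} → x ∈ fvᵗˢ ts → v x ≡ w x) →
        evals M v ts ≡ evals M w ts
      evals-cong []       v≗w = refl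
      evals-cong (t ∷ ts) v≗w = cong₂ _∷_
        (eval-cong t (v≗w ∘ ∈-++⁺ˡ)) (evals-cong ts (v≗w ∘ ∈-++⁺ʳ (fvᵗ t)))

    update-other : ∀ v {x a y} → ¬ y ≡ x → (v ⟨ x ≔ a ⟩) y ≡ v y
    update-other v {x} {y = y} y≢x with y ≡ᵇ x | ≡ᵇ⇒≡ y x
    ... | Bool.true  | y≡x = ⊥-elim (y≢x (y≡x tt))
    ... | Bool.false | _   = refl

    update-cong : ∀ {v w : Assignment M} {x a xs} → (∀ {y} → y ∈ xs ∖ [ x ] → v y ≡ w y) →
      ∀ {y} → y ∈ xs → (v ⟨ x ≔ a ⟩) y ≡ (w ⟨ x ≔ a ⟩) y
    update-cong {x = x} v≗w {y} y∈xs with y ≡ᵇ x | ≡⇒≡ᵇ y x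
    ... | Bool.true  | _   = refl
    ... | Bool.false | y≢x = v≗w (∈-∖⁺ y∈xs λ { (here y≡x) → y≢x y≡x })

    Satᵇ-cong : ∀ {v w} c → (∀ {x} → x ∈ fvᵇ c → v x ≡ w x) → Satᵇ M v c → Satᵇ M w c
    Satᵇ-cong true        v≗w = id
    Satᵇ-cong (atom R ts) v≗w = subst ⟦ R ⟧ʳ (evals-cong ts v≗w)
    Satᵇ-cong (s ≐ t)     v≗w = subst id (cong₂ _≈_
      (eval-cong s (v≗w ∘ ∈-++⁺ˡ)) (eval-cong t (v≗w ∘ ∈-++⁺ʳ (fvᵗ s))))
    Satᵇ-cong (c ∧ d)     v≗w (p , q) =
      Satᵇ-cong c (v≗w ∘ ∈-++⁺ˡ) p , Satᵇ-cong d (v≗w ∘ ∈-++⁺ʳ (fvᵇ c)) q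
    Satᵇ-cong (∃ᵇ x c)    v≗w p none =
      p λ a q → none a (Satᵇ-cong c (update-cong v≗w) q)

    Satᵇ-stable : ∀ v c → ¬ ¬ Satᵇ M v c → Satᵇ M v c
    Satᵇ-stable v true        p = tt
    Satᵇ-stable v (atom R ts) p = ⟦⟧ʳ-stable R p
    Satᵇ-stable v (s ≐ t)     p = ≈-stable p
    Satᵇ-stable v (c ∧ d)     p =
      Satᵇ-stable v c (λ k → p (k ∘ proj₁)) , Satᵇ-stable v d (λ k → p (k ∘ proj₂))
    Satᵇ-stable v (∃ᵇ x c)    p none = p λ q → q none

    -- Nonemptiness of the domain supplies the witnesses.
    ∃⋆-valid : ∀ xs c → (∀ v → Satᵇ M v c) → ∀ v → Satᵇ M v (∃⋆ xs c)
    ∃⋆-valid []       c valid v      = valid v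
    ∃⋆-valid (x ∷ xs) c valid v none = none point (∃⋆-valid xs c valid _)

  -- Solvability of built-in stores

  module _ (CT : Theory) where
    open Semantics CT

    ∃⋆-elim : ∀ M xs c v → Satᵇ M v (∃⋆ xs c) →
      ¬ ¬ (∃ λ w → AgreeOff M xs v w × Satᵇ M w c)
    ∃⋆-elim M []       c v p k = k (v , (λ _ _ → refl) , p)
    ∃⋆-elim M (x ∷ xs) c v p k = p λ a q → ∃⋆-elim M xs c _ q λ (w , off , r) →
      k (w , (λ y y∉ → ≡.trans (off y (y∉ ∘ there)) (update-other M v (y∉ ∘ here))) , r)

    -- The semantic content of an answer that holds in every model, with `W` the variables of the
    -- goal. It is phrased by assignments because data sufficient and qualified answers quantify
    -- over different lists of variables.
    Solvable : List Var → BuiltIn → Set₁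
    Solvable W d = ∀ M → IsModel CT M → (v : Assignment M) →
      ¬ ¬ (∃ λ (w : Assignment M) → (∀ {x} → x ∈ W → w x ≡ v x) × Satᵇ M w d)

    AgreeOff-∖ : ∀ M xs ys {v w : Assignment M} → AgreeOff M (xs ∖ ys) v w → ∀ {x} → x ∈ ys → w x ≡ v x
    AgreeOff-∖ M xs ys off {x} x∈ys = off x λ x∈ → proj₂ (∈-∖⁻ xs ys x∈) x∈ys

    valid⇒solvable : ∀ W d → CT ⊨ ⌈ ∃⋆ (fvᵇ d ∖ W) d ⌉ → Solvable W d
    valid⇒solvable W d valid M mod v k = ∃⋆-elim M (fvᵇ d ∖ W) d v (valid M mod v)
      λ (w , off , p) → k (w , AgreeOff-∖ M (fvᵇ d) W {v} {w} off , p)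

    Step-strengthens : ∀ {Π} {P : Program′ Π} {V γ γ′} → Step P V γ γ′ →
      CT ⊨ ⌈ Config.built γ′ ⌉ implies ⌈ Config.built γ ⌉
    Step-strengthens (solve c _ c∧d⇔d′)           M mod v p = proj₂ (proj₂ (c∧d⇔d′ M mod v) p)
    Step-strengthens (introduce h _)              M mod v p = p
    Step-strengthens (simplify _ _ _ _ H=H′ _)    M mod v p = proj₂ p
    Step-strengthens (propagate _ _ _ _ H=H′ _)   M mod v p = proj₂ p

    ⟶⋆-strengthens : ∀ {Π} {P : Program′ Π} {V V′ γ γ′} → P ⊢ (V , γ) ⟶⋆ (V′ , γ′) →
      CT ⊨ ⌈ Config.built γ′ ⌉ implies ⌈ Config.built γ ⌉
    ⟶⋆-strengthens ε            M mod v p = p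
    ⟶⋆-strengthens (step s ◅ t) M mod v p =
      Step-strengthens s M mod v (⟶⋆-strengthens t M mod v p)

    -- Steps local to one part of a configuration

    module _ {Π : Vocabulary} where
      open Config {Π}

      -- The built-in stores are related by equivalence only, since `solve` may pass to any
      -- equivalent constraint.
      record Parts (γ γ₁ γ₂ : Config Π) : Set₁ where
        constructor parts
        field
          goal↭  : goal γ ↭ goal γ₁ ++ goal γ₂
          store↭ : store γ ↭ store γ₁ ++ store γ₂
          built⇔ : built γ ≈ᵇ (built γ₁ ∧ built γ₂)

      Parts-sym : ∀ {γ γ₁ γ₂} → Parts γ γ₁ γ₂ → Parts γ γ₂ γ₁
      Parts-sym {γ₁ = γ₁} {γ₂} (parts g s b) = parts
        (↭-trans g (++-comm (goal γ₁) (goal γ₂)))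
        (↭-trans s (++-comm (store γ₁) (store γ₂)))
        λ M mod v → swap ∘ proj₁ (b M mod v) , proj₂ (b M mod v) ∘ swap

      -- A variable new to the part is fresh for the whole derivation. It must also occur in `γ′`,
      -- so that it joins the variables recorded as seen.
      Introduces : List Var → Config Π → Config Π → Config Π → Set
      Introduces V γ′ γ₁ γ₁′ =
        ∀ {x} → x ∈ fvᶜᶠ γ₁′ → x ∈ fvᶜᶠ γ₁ ⊎ (x ∉ V × x ∈ fvᶜᶠ γ′)

      -- `c` stands for the applicability condition of a rule. Its variables are seen by the part
      -- alone or fresh for the whole; variables private to the other part are excluded, as its
      -- constraints may restrict them.
      Conservative : List Var → List Var → BuiltIn → BuiltIn → Set₁
      Conservative V U d d₁ = ∀ c → (∀ {x} → x ∈ fvᵇ c → x ∈ U ⊎ x ∉ V) →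
        CT ⊨ ⌈ d ⌉ implies ⌈ c ⌉ → CT ⊨ ⌈ d₁ ⌉ implies ⌈ c ⌉

      -- In local, U holds the variables seen when γ₁ runs alone, fewer than
      -- the V seen by γ, so a variant fresh for V is fresh for U as well.
      record LocalStep (P : Program′ Π) (V : List Var) (γ γ′ γ₁ γ₂ : Config Π) : Set₁ where
        field
          {result}   : Config Π
          local      : ∀ {U} → U ⊆ V → fvᶜᶠ γ₁ ⊆ U → Conservative V U (built γ) (built γ₁) →
                       Step P U γ₁ result
          remains    : Parts γ′ result γ₂
          introduces : Introduces V γ′ γ₁ result

      module _ (γ : Config Π) where
        fvᵍ⊆ : fvᵍ (goal γ) ⊆ fvᶜᶠ γ
        fvᵍ⊆ = ∈-++⁺ˡ

        fvᵃˢ⊆ : fvᵃˢ (store γ) ⊆ fvᶜᶠ γ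
        fvᵃˢ⊆ = ∈-++⁺ʳ (fvᵍ (goal γ)) ∘ ∈-++⁺ˡ

        fvᵇ⊆ : fvᵇ (built γ) ⊆ fvᶜᶠ γ
        fvᵇ⊆ = ∈-++⁺ʳ (fvᵍ (goal γ)) ∘ ∈-++⁺ʳ (fvᵃˢ (store γ))

        fvᶜᶠ-case : ∀ {a} {A : Set a} {x} → (x ∈ fvᵍ (goal γ) → A) → (x ∈ fvᵃˢ (store γ) → A) →
          (x ∈ fvᵇ (built γ) → A) → x ∈ fvᶜᶠ γ → A
        fvᶜᶠ-case f g h =
          [ f , [ g , h ]′ ∘ ∈-++⁻ (fvᵃˢ (store γ)) ]′ ∘ ∈-++⁻ (fvᵍ (goal γ))

      local-solve : ∀ {P V G G′ K d d′ c γ₁ γ₂} → Parts ⟨ G , K , d ⟩ γ₁ γ₂ →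
        G ↭ builtin c ∷ G′ → CT ⊨ ⌈ c ∧ d ⌉ iff ⌈ d′ ⌉ → builtin c ∈ goal γ₁ →
        LocalStep P V ⟨ G , K , d ⟩ ⟨ G′ , K , d′ ⟩ γ₁ γ₂
      local-solve {c = c} {γ₁} (parts g s b) p c∧d⇔d′ c∈
        with G₁′ , q , r ← ∈-++-extract c∈ (↭-trans (↭-sym g) p) = record
        -- `d′` describes the joint store, so the local step keeps the plain conjunction instead.
        { result  = ⟨ G₁′ , store γ₁ , c ∧ built γ₁ ⟩
        ; local   = λ _ _ _ → solve c q λ _ _ _ → id , id
        ; remains = parts r s λ M mod v →
            (λ x → let (y , z) = proj₂ (c∧d⇔d′ M mod v) x ; (u , w) = proj₁ (b M mod v) z in (y , u) , w) ,
            λ ((x , y) , z) → proj₁ (c∧d⇔d′ M mod v) (x , proj₂ (b M mod v) (y , z))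
        ; introduces = inj₁ ∘ fvᶜᶠ-case ⟨ G₁′ , store γ₁ , c ∧ built γ₁ ⟩
            (fvᵍ⊆ γ₁ ∘ G₁⊇ ∘ there′)
            (fvᵃˢ⊆ γ₁)
            ([ fvᵍ⊆ γ₁ ∘ G₁⊇ ∘ ∈-++⁺ˡ , fvᵇ⊆ γ₁ ]′ ∘ ∈-++⁻ (fvᵇ c))
        }
        where
        G₁⊇ : fvᵍ (builtin c ∷ G₁′) ⊆ fvᵍ (goal γ₁)
        G₁⊇ = concatMap⁺ fvᶜ (∈-resp-↭ (↭-sym q))
        there′ : fvᵍ G₁′ ⊆ fvᵍ (builtin c ∷ G₁′)
        there′ = ∈-++⁺ʳ (fvᵇ c)

      local-introduce : ∀ {P V G G′ K d h γ₁ γ₂} → Parts ⟨ G , K , d ⟩ γ₁ γ₂ →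
        G ↭ user h ∷ G′ → user h ∈ goal γ₁ →
        LocalStep P V ⟨ G , K , d ⟩ ⟨ G′ , h ∷ K , d ⟩ γ₁ γ₂
      local-introduce {h = h} {γ₁} (parts g s b) p h∈
        with G₁′ , q , r ← ∈-++-extract h∈ (↭-trans (↭-sym g) p) = record
        { result  = ⟨ G₁′ , h ∷ store γ₁ , built γ₁ ⟩
        ; local   = λ _ _ _ → introduce h q
        ; remains = parts r (prep h s) b
        ; introduces = inj₁ ∘ fvᶜᶠ-case ⟨ G₁′ , h ∷ store γ₁ , built γ₁ ⟩
            (fvᵍ⊆ γ₁ ∘ G₁⊇ ∘ ∈-++⁺ʳ (fvᵃ h))
            ([ fvᵍ⊆ γ₁ ∘ G₁⊇ ∘ ∈-++⁺ˡ , fvᵃˢ⊆ γ₁ ]′ ∘ ∈-++⁻ (fvᵃ h))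
            (fvᵇ⊆ γ₁)
        }
        where
        G₁⊇ : fvᵍ (user h ∷ G₁′) ⊆ fvᵍ (goal γ₁)
        G₁⊇ = concatMap⁺ fvᶜ (∈-resp-↭ (↭-sym q))

      -- Common to simplification and propagation, which differ only in the stores left behind: `K*`
      -- for the whole and `K₁*` for the first part.
      module Firing {V : List Var} {r r′ : Rule Π} {h : Atom Π} {G : Goal Π} {K K* K₁* : List (Atom Π)}
        {d : BuiltIn} {γ₁ γ₂ : Config Π}
        (fresh : FreshVariant V r r′) (es : Pointwise _~_ (headᵐ r′) [ h ])
        (γ-parts : Parts ⟨ G , K , d ⟩ γ₁ γ₂) (h∈ : h ∈ store γ₁)
        (K*↭ : K* ↭ K₁* ++ store γ₂) (K₁*⊆ : K₁* ⊆ store γ₁) where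

        γ′ γ₁′ : Config Π
        γ′  = ⟨ body r′ ++ G , K* , equations es ∧ d ⟩
        γ₁′ = ⟨ body r′ ++ goal γ₁ , K₁* , equations es ∧ built γ₁ ⟩

        h⊆ : [ h ] ⊆ store γ₁
        h⊆ (here refl) = h∈

        fv-h : fvᵃˢ [ h ] ⊆ fvᶜᶠ γ₁
        fv-h = fvᵃˢ⊆ γ₁ ∘ concatMap⁺ fvᵃ h⊆

        head⊆ : fvᵃˢ (headᵐ r′) ⊆ fvʳ r′
        head⊆ = ∈-++⁺ˡ

        guard⊆ : concatMap fvᵇ (guard r′) ⊆ fvʳ r′
        guard⊆ = ∈-++⁺ʳ (fvᵃˢ (headᵐ r′)) ∘ ∈-++⁺ˡ

        body⊆ : fvᵍ (body r′) ⊆ fvʳ r′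
        body⊆ = ∈-++⁺ʳ (fvᵃˢ (headᵐ r′)) ∘ ∈-++⁺ʳ (concatMap fvᵇ (guard r′))

        ∉V : ∀ {x} → x ∈ fvʳ r′ → x ∉ V
        ∉V = proj₂ (proj₂ (proj₂ fresh))

        remains : Parts γ′ γ₁′ γ₂
        remains = parts
          (↭-trans (++⁺ˡ (body r′) (Parts.goal↭ γ-parts)) (↭-sym (++-assoc (body r′) (goal γ₁) (goal γ₂))))
          K*↭
          λ M mod v →
            (λ (e , p) → let (p₁ , p₂) = proj₁ (Parts.built⇔ γ-parts M mod v) p in (e , p₁) , p₂) ,
            λ ((e , p₁) , p₂) → e , proj₂ (Parts.built⇔ γ-parts M mod v) (p₁ , p₂)

        introduces : Introduces V γ′ γ₁ γ₁′
        introduces = fvᶜᶠ-case γ₁′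
          ([ (λ x∈ → inj₂ (∉V (body⊆ x∈) , fvᵍ⊆ γ′ (fvᵍ-++⁺ˡ (body r′) x∈))) , inj₁ ∘ fvᵍ⊆ γ₁ ]′ ∘ fvᵍ-++⁻ (body r′))
          (inj₁ ∘ fvᵃˢ⊆ γ₁ ∘ concatMap⁺ fvᵃ K₁*⊆)
          ([ (λ x∈ → [ (λ x∈H → inj₂ (∉V (head⊆ x∈H) , fvᵇ⊆ γ′ (∈-++⁺ˡ x∈))) , inj₁ ∘ fv-h ]′ (fv-equations es x∈))
           , inj₁ ∘ fvᵇ⊆ γ₁ ]′ ∘ ∈-++⁻ (fvᵇ (equations es)))

        FreshVariant-⊆ : ∀ {U} → U ⊆ V → FreshVariant U r r′
        FreshVariant-⊆ U⊆V = let ρ , inj , eq , _ = fresh in ρ , inj , eq , λ x∈ → ∉V x∈ ∘ U⊆V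

        -- The condition mentions only variables of the variant, which avoid `V`, and of the matched
        -- atom, which belongs to `γ₁`; hence conservativity covers it.
        applicable : ∀ {U} → fvᶜᶠ γ₁ ⊆ U → Conservative V U d (built γ₁) →
          Applicable r′ es d → Applicable r′ es (built γ₁)
        applicable ⊆U conservative = conservative
          (∃⋆ (fvᵃˢ (headᵐ r′)) (equations es ∧ ⋀ (guard r′)))
          ([ [ inj₂ ∘ ∉V ∘ head⊆ , inj₁ ∘ ⊆U ∘ fv-h ]′ ∘ fv-equations es
           , inj₂ ∘ ∉V ∘ guard⊆ ∘ fv-⋀ (guard r′) ]′
           ∘ ∈-++⁻ (fvᵇ (equations es))
           ∘ fv-∃⋆ (fvᵃˢ (headᵐ r′)) (equations es ∧ ⋀ (guard r′)))

      module _ {P : Program′ Π} {V : List Var} {G : Goal Π} {K K′ : List (Atom Π)} {d : BuiltIn}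
        {r r′ : Rule Π} {h : Atom Π} {γ₁ γ₂ : Config Π}
        (r∈P : r ∈ P) (fresh : FreshVariant V r r′)
        (K↭ : K ↭ h ∷ K′) (es : Pointwise _~_ (headᵐ r′) [ h ]) (app : Applicable r′ es d)
        (γ-parts : Parts ⟨ G , K , d ⟩ γ₁ γ₂) (h∈ : h ∈ store γ₁) where

        local-simplify : kind r ≡ simplification →
          LocalStep P V ⟨ G , K , d ⟩ ⟨ body r′ ++ G , K′ , equations es ∧ d ⟩ γ₁ γ₂
        local-simplify simp
          with K₁′ , p , q ← ∈-++-extract h∈ (↭-trans (↭-sym (Parts.store↭ γ-parts)) K↭) = record
          { local      = λ U⊆V ⊆U conservative →
              simplify r∈P simp (F.FreshVariant-⊆ U⊆V) p es (F.applicable ⊆U conservative app)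
          ; remains    = F.remains
          ; introduces = F.introduces
          }
          where module F = Firing fresh es γ-parts h∈ q (∈-resp-↭ (↭-sym p) ∘ there)

        local-propagate : kind r ≡ propagation →
          LocalStep P V ⟨ G , K , d ⟩ ⟨ body r′ ++ G , h ∷ K′ , equations es ∧ d ⟩ γ₁ γ₂
        local-propagate prop
          with K₁′ , p , q ← ∈-++-extract h∈ (↭-trans (↭-sym (Parts.store↭ γ-parts)) K↭) = record
          { local      = λ U⊆V ⊆U conservative →
              propagate r∈P prop (F.FreshVariant-⊆ U⊆V) p es (F.applicable ⊆U conservative app)
          ; remains    = F.remains
          ; introduces = F.introduces
          }
          where module F = Firing fresh es γ-parts h∈ (prep h q) (∈-resp-↭ (↭-sym p))

      -- Projecting derivations of single-headed programs

      SingleHeaded : Rule Π → Set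
      SingleHeaded r = List⁺.length (head r) ≡ 1

      Pointwise-map-singleton : ∀ {A B : Set} {R : B → B → Set} {f : A → B} (xs : List⁺ A) {ys} →
        List⁺.length xs ≡ 1 → Pointwise R (List⁺.toList (List⁺.map f xs)) ys → ∃ λ y → ys ≡ [ y ]
      Pointwise-map-singleton (x ∷ []) _ (_ ∷ []) = _ , refl

      matches-singleton : ∀ {V} {r r′ : Rule Π} {H′} → SingleHeaded r → FreshVariant V r r′ →
        Pointwise _~_ (headᵐ r′) H′ → ∃ λ h → H′ ≡ [ h ]
      matches-singleton {r = r} single (_ , _ , refl , _) = Pointwise-map-singleton (head r) single

      -- The selected constraint lies in one of the two parts, and a head with one atom asks nothing
      -- of the other.
      locate : ∀ {P V γ γ′ γ₁ γ₂} → All SingleHeaded P → Parts γ γ₁ γ₂ → Step P V γ γ′ →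
        LocalStep P V γ γ′ γ₁ γ₂ ⊎ LocalStep P V γ γ′ γ₂ γ₁
      locate {γ₁ = γ₁} _ γ-parts (solve c p e) =
        Sum.map (local-solve γ-parts p e) (local-solve (Parts-sym γ-parts) p e)
          (∈-++⁻ (goal γ₁) (∈-resp-↭ (↭-trans (↭-sym p) (Parts.goal↭ γ-parts)) (here refl)))
      locate {γ₁ = γ₁} _ γ-parts (introduce h p) =
        Sum.map (local-introduce γ-parts p) (local-introduce (Parts-sym γ-parts) p)
          (∈-++⁻ (goal γ₁) (∈-resp-↭ (↭-trans (↭-sym p) (Parts.goal↭ γ-parts)) (here refl)))
      locate {γ₁ = γ₁} single γ-parts (simplify r∈P simp fresh K↭ es app)
        with h , refl ← matches-singleton (All.lookup single r∈P) fresh es =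
        Sum.map
          (λ h∈ → local-simplify r∈P fresh K↭ es app γ-parts h∈ simp)
          (λ h∈ → local-simplify r∈P fresh K↭ es app (Parts-sym γ-parts) h∈ simp)
          (∈-++⁻ (store γ₁) (∈-resp-↭ (↭-trans (↭-sym K↭) (Parts.store↭ γ-parts)) (here refl)))
      locate {γ₁ = γ₁} single γ-parts (propagate r∈P prop fresh K↭ es app)
        with h , refl ← matches-singleton (All.lookup single r∈P) fresh es =
        Sum.map
          (λ h∈ → local-propagate r∈P fresh K↭ es app γ-parts h∈ prop)
          (λ h∈ → local-propagate r∈P fresh K↭ es app (Parts-sym γ-parts) h∈ prop)
          (∈-++⁻ (store γ₁) (∈-resp-↭ (↭-trans (↭-sym K↭) (Parts.store↭ γ-parts)) (here refl)))

      -- V lists the variables seen by the whole derivation and V₁ those seen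
      -- by the derivation from the first part alone.
      record Split (W V V₁ : List Var) (γ γ₁ γ₂ : Config Π) : Set₁ where
        field
          γ-parts : Parts γ γ₁ γ₂
          V₁⊆V    : V₁ ⊆ V
          fv₁     : fvᶜᶠ γ₁ ⊆ V₁
          fv₂     : fvᶜᶠ γ₂ ⊆ V
          shared  : ∀ {x} → x ∈ fvᶜᶠ γ₂ → x ∈ V₁ → x ∈ W

      introduces-⊆ : ∀ {V U} γ′ γ₁ γ₁′ → Introduces V γ′ γ₁ γ₁′ → fvᶜᶠ γ₁ ⊆ U → fvᶜᶠ γ₁′ ⊆ U ++ fvᶜᶠ γ′
      introduces-⊆ {U = U} _ _ _ intro γ₁⊆U = [ ∈-++⁺ˡ ∘ γ₁⊆U , ∈-++⁺ʳ U ∘ proj₂ ]′ ∘ intro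

      module _ {W V V₁ : List Var} {γ γ₁ γ₂ : Config Π} (split : Split W V V₁ γ γ₁ γ₂) where
        open Split split

        -- A solution of the second part can be changed to take any prescribed
        -- values outside the variables private to that part.
        Split-conservative : Solvable W (built γ) → Conservative V V₁ (built γ) (built γ₁)
        Split-conservative solvable c fv-c γ⊨c M mod v p₁ =
          Satᵇ-stable M v c λ ¬c → solvable M mod v λ (w , w≗v , p) →
            let
              private? x = ¬? (x ∈? V₁) ×-dec (x ∈? V)

              u : Assignment M
              u x = if does (private? x) then w x else v x

              v≗u : ∀ {x} → ¬ (x ∉ V₁ × x ∈ V) → v x ≡ u x
              v≗u {x} ¬private =
                cong (if_then w x else v x) (≡.sym (dec-false (private? x) ¬private))

              w≗u : ∀ {x} → x ∈ fvᶜᶠ γ₂ → w x ≡ u x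
              w≗u {x} x∈ = case x ∈? V₁ of λ where
                (yes x∈V₁) → ≡.trans (w≗v (shared x∈ x∈V₁)) (v≗u λ (x∉V₁ , _) → x∉V₁ x∈V₁)
                (no x∉V₁)  → cong (if_then w x else v x)
                  (≡.sym (dec-true (private? x) (x∉V₁ , fv₂ x∈)))

              v≗u₁ : ∀ {x} → x ∈ V₁ → v x ≡ u x
              v≗u₁ x∈V₁ = v≗u λ (x∉V₁ , _) → x∉V₁ x∈V₁
            -- `u` satisfies the first store as `v` does and the second as `w` does, so it satisfies
            -- `c`; as `c` has no private variables, `v` satisfies it too.
            in ¬c (Satᵇ-cong M c (λ x∈ → ≡.sym ([ v≗u₁ , (λ x∉V → v≗u (x∉V ∘ proj₂)) ]′ (fv-c x∈)))
                 (γ⊨c M mod u (proj₂ (Parts.built⇔ γ-parts M mod u)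
                   ( Satᵇ-cong M (built γ₁) (v≗u₁ ∘ fv₁ ∘ fvᵇ⊆ γ₁) p₁
                   , Satᵇ-cong M (built γ₂) (w≗u ∘ fvᵇ⊆ γ₂) (proj₂ (proj₁ (Parts.built⇔ γ-parts M mod w) p))))))

        -- New variables of the first part lie outside `V`, while those of the second lie inside, so
        -- no new sharing arises.
        Split-advance₁ : ∀ {γ′ γ₁′} → Parts γ′ γ₁′ γ₂ → Introduces V γ′ γ₁ γ₁′ →
          Split W (V ++ fvᶜᶠ γ′) (V₁ ++ fvᶜᶠ γ₁′) γ′ γ₁′ γ₂
        Split-advance₁ {γ′} {γ₁′} remains intro = record
          { γ-parts = remains
          ; V₁⊆V    = [ ∈-++⁺ˡ ∘ V₁⊆V , introduces-⊆ γ′ γ₁ γ₁′ intro (V₁⊆V ∘ fv₁) ]′ ∘ ∈-++⁻ V₁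
          ; fv₁     = ∈-++⁺ʳ V₁
          ; fv₂     = ∈-++⁺ˡ ∘ fv₂
          ; shared  = λ x∈₂ → shared x∈₂ ∘
              [ id , [ fv₁ , (λ (x∉V , _) → ⊥-elim (x∉V (fv₂ x∈₂))) ]′ ∘ intro ]′ ∘ ∈-++⁻ V₁
          }

        -- The first part stands still, so `V₁` does not grow; new variables of the second part
        -- avoid `V` and with it `V₁`.
        Split-advance₂ : ∀ {γ′ γ₂′} → Parts γ′ γ₁ γ₂′ → Introduces V γ′ γ₂ γ₂′ →
          Split W (V ++ fvᶜᶠ γ′) V₁ γ′ γ₁ γ₂′
        Split-advance₂ {γ′} {γ₂′} remains intro = record
          { γ-parts = remains
          ; V₁⊆V    = ∈-++⁺ˡ ∘ V₁⊆V
          ; fv₁     = fv₁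
          ; fv₂     = introduces-⊆ γ′ γ₂ γ₂′ intro fv₂
          ; shared  = λ x∈₂′ x∈V₁ →
              [ (λ x∈₂ → shared x∈₂ x∈V₁) , (λ (x∉V , _) → ⊥-elim (x∉V (V₁⊆V x∈V₁))) ]′ (intro x∈₂′)
          }

      -- By induction on the derivation: steps of the first part are replayed, those of the second
      -- skipped.
      project : ∀ {P W V V′ V₁ γ γ₁ γ₂ K d} → All SingleHeaded P →
        P ⊢ (V , γ) ⟶⋆ (V′ , ⟨ [] , K , d ⟩) → Solvable W d → Split W V V₁ γ γ₁ γ₂ →
        ∃ λ V₁′ → ∃ λ K₁ → ∃ λ K₂ → ∃ λ d₁ →
          P ⊢ (V₁ , γ₁) ⟶⋆ (V₁′ , ⟨ [] , K₁ , d₁ ⟩) × K ↭ K₁ ++ K₂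
      project {γ₁ = γ₁} single ε solvable split
        with refl ← List.++-conicalˡ (goal γ₁) _ (↭-empty-inv (↭-sym (Parts.goal↭ (Split.γ-parts split)))) =
        _ , _ , _ , _ , ε , Parts.store↭ (Split.γ-parts split)
      project {W = W} {γ = γ} {d = d} single (step s ◅ t) solvable split with locate single (Split.γ-parts split) s
      ... | inj₁ ls with V₁′ , K₁ , K₂ , d₁ , t₁ , K↭ ←
          project single t solvable (Split-advance₁ split (LocalStep.remains ls) (LocalStep.introduces ls)) =
        V₁′ , K₁ , K₂ , d₁ , step s₁ ◅ t₁ , K↭
        where
        -- Stores only get stronger along a derivation, so a solution of the final store also solves
        -- the present one.
        solvable-γ : Solvable W (built γ)
        solvable-γ M mod v k = solvable M mod v λ (w , w≗v , p) →
          k (w , w≗v , ⟶⋆-strengthens (step s ◅ t) M mod w p)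
        s₁ : Step _ _ _ _
        s₁ = LocalStep.local ls (Split.V₁⊆V split) (Split.fv₁ split) (Split-conservative split solvable-γ)
      ... | inj₂ ls = project single t solvable
        (Split-advance₂ split (Parts-sym (LocalStep.remains ls)) (LocalStep.introduces ls))

      start-split : ∀ {G G₁ G₂} → G ↭ G₁ ++ G₂ →
        Split (fvᵍ G) (fvᵍ G) (fvᵍ G₁) ⟨ G , [] , true ⟩ ⟨ G₁ , [] , true ⟩ ⟨ G₂ , [] , true ⟩
      start-split {G} {G₁} {G₂} G↭ = record
        { γ-parts = parts G↭ ↭-refl λ _ _ _ → (λ _ → tt , tt) , (λ _ → tt)
        ; V₁⊆V    = G₁⊆
        ; fv₁     = fvᶜᶠ-start G₁
        ; fv₂     = G₂⊆ ∘ fvᶜᶠ-start G₂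
        ; shared  = λ x∈ _ → G₂⊆ (fvᶜᶠ-start G₂ x∈)
        }
        where
        fvᶜᶠ-start : ∀ G → fvᶜᶠ ⟨ G , [] , true ⟩ ⊆ fvᵍ G
        fvᶜᶠ-start G = fvᶜᶠ-case ⟨ G , [] , true ⟩ id (λ ()) (λ ())
        G₁⊆ : fvᵍ G₁ ⊆ fvᵍ G
        G₁⊆ = concatMap⁺ fvᶜ (∈-resp-↭ (↭-sym G↭) ∘ xs⊆xs++ys G₁ G₂)
        G₂⊆ : fvᵍ G₂ ⊆ fvᵍ G
        G₂⊆ = concatMap⁺ fvᶜ (∈-resp-↭ (↭-sym G↭) ∘ xs⊆ys++xs G₂ G₁)

      -- Final configurations of a part

      empty-̸⟶ : ∀ (P : Program′ Π) {V d} → P ⊢ (V , ⟨ [] , [] , d ⟩) ̸⟶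
      empty-̸⟶ P _ (step (solve _ p _))                     = ¬x∷xs↭[] (↭-sym p)
      empty-̸⟶ P _ (step (introduce _ p))                   = ¬x∷xs↭[] (↭-sym p)
      empty-̸⟶ P _ (step (simplify _ _ _ p (_ ∷ _) _))      = ¬x∷xs↭[] (↭-sym p)
      empty-̸⟶ P _ (step (propagate _ _ _ p (_ ∷ _) _))     = ¬x∷xs↭[] (↭-sym p)

      fresh-variant : ∀ V (r : Rule Π) → ∃ λ ρ → FreshVariant V r (renameʳ ρ r)
      fresh-variant V r = ρ , ρ , +-cancelˡ-≡ _ _ _ , refl , λ x∈ x∈V → avoids (fv-renameʳ ρ r x∈) x∈V
        where
        ρ : Var → Var
        -- The shift moves every variable strictly above all of `V`.
        ρ = ℕ.suc (max 0 V) +_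
        avoids : ∀ {x} → (∃ λ y → x ≡ ρ y) → x ∉ V
        avoids (y , refl) x∈V = <⇒≱ (m≤m+n (ℕ.suc (max 0 V)) y) (All.lookup (xs≤max 0 V) x∈V)

      -- Without models every condition is entailed, so a rule applies as soon as its head matches.
      -- A match in `K₁` is a match in `K`, after renaming the rule apart from `V` instead of `V₁`.
      inconsistent-̸⟶ : (∀ M → ¬ IsModel CT M) → ∀ {P : Program′ Π} {V V₁ K K₁ K₂ d d₁} →
        K ↭ K₁ ++ K₂ → P ⊢ (V , ⟨ [] , K , d ⟩) ̸⟶ → P ⊢ (V₁ , ⟨ [] , K₁ , d₁ ⟩) ̸⟶
      inconsistent-̸⟶ _ _ _ _ (step (solve _ p _))   = ¬x∷xs↭[] (↭-sym p)
      inconsistent-̸⟶ _ _ _ _ (step (introduce _ p)) = ¬x∷xs↭[] (↭-sym p)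
      inconsistent-̸⟶ no-model {V = V} {K₂ = K₂} K↭ stuck _
        (step (simplify {K′ = K′} {H′ = H′} {r = r} r∈P simp (_ , _ , refl , _) p es _)) =
        let ρ , fresh = fresh-variant V r in
        stuck _ (step (simplify r∈P simp fresh
          (↭-trans K↭ (↭-trans (++⁺ʳ K₂ p) (++-assoc H′ K′ K₂)))
          (~-rename ρ (headᵐ r) es) λ M mod → ⊥-elim (no-model M mod)))
      inconsistent-̸⟶ no-model {V = V} {K₂ = K₂} K↭ stuck _
        (step (propagate {K′ = K′} {H′ = H′} {r = r} r∈P prop (_ , _ , refl , _) p es _)) =
        let ρ , fresh = fresh-variant V r in
        stuck _ (step (propagate r∈P prop fresh
          (↭-trans K↭ (↭-trans (++⁺ʳ K₂ p) (++-assoc H′ K′ K₂)))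
          (~-rename ρ (headᵐ r) es) λ M mod → ⊥-elim (no-model M mod)))

      module _ {P : Program′ Π} {G G₁ G₂ : Goal Π} (single : All SingleHeaded P) (G↭ : G ↭ G₁ ++ G₂) where

        -- The store of the part is contained in the empty store, and a configuration with empty
        -- goal and store is final whatever its built-in constraint.
        final-empty-part : ∀ {d} → FinalConfig P G [] d → Solvable (fvᵍ G) d →
          ∃ λ d₁ → FinalConfig P G₁ [] d₁
        final-empty-part (_ , t , _) solvable
          with V₁ , K₁ , _ , d₁ , t₁ , K↭ ← project single t solvable (start-split G↭)
          with refl ← List.++-conicalˡ K₁ _ (↭-empty-inv (↭-sym K↭)) =
          d₁ , V₁ , t₁ , empty-̸⟶ P

        -- Solvability is vacuous here, so projection applies even when the final store is nonempty.
        final-part-inconsistent : (∀ M → ¬ IsModel CT M) → ∀ {K d} → FinalConfig P G K d →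
          ∃ λ K₁ → ∃ λ d₁ → FinalConfig P G₁ K₁ d₁
        final-part-inconsistent no-model (_ , t , stuck)
          with V₁ , K₁ , _ , d₁ , t₁ , K↭ ←
            project single t (λ M mod → ⊥-elim (no-model M mod)) (start-split G↭) =
          K₁ , d₁ , V₁ , t₁ , inconsistent-̸⟶ no-model K↭ stuck

    -- The source program and its two goals

    ~-refl : ∀ {Π} (h : Atom Π) → h ~ h
    ~-refl (p $ ts) = same p ts ts

    equationᵃ-refl : ∀ {Π} (h : Atom Π) M v → Satᵇ M v (equationᵃ (~-refl h))
    equationᵃ-refl (p $ ts) M v = go ts
      where
      go : ∀ {n} (ts : Vec Term n) → Satᵇ M v (⋀ (Vec.toList (Vec.zipWith _≐_ ts ts)))
      go []       = tt
      go (t ∷ ts) = Setoid.refl (Structure.domain M) , go ts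

    module Pairing {Π : Vocabulary} (a : Atom Π) (fv-a : fvᵃ a ≡ [])
      (rename-a : ∀ ρ → renameᵃ ρ a ≡ a) where

      loop pair : Rule Π
      loop = mkRule propagation    (a ∷ []) [] []
      pair = mkRule simplification (a ∷ a ∷ []) [] []

      P : Program′ Π
      P = loop ∷ pair ∷ []

      -- A rule without variables is its own variant, fresh for any `V`.
      loop-fresh : ∀ V → FreshVariant V loop loop
      loop-fresh V = id , id , cong (λ h → mkRule propagation (h ∷ []) [] []) (≡.sym (rename-a id)) ,
        λ x∈ → case subst (_ ∈_) fv-loop x∈ of λ ()
        where
        fv-loop : fvʳ loop ≡ []
        fv-loop rewrite fv-a = refl

      pair-fresh : ∀ V → FreshVariant V pair pair
      pair-fresh V = id , id , cong (λ h → mkRule simplification (h ∷ h ∷ []) [] []) (≡.sym (rename-a id)) ,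
        λ x∈ → case subst (_ ∈_) fv-pair x∈ of λ ()
        where
        fv-pair : fvʳ pair ≡ []
        fv-pair rewrite fv-a = refl

      -- Invariant of derivations from the goal `a`; `d` is left open because each firing of `loop`
      -- adds equations.
      data Unpaired : Config Π → Set where
        pending : ∀ {d} → Unpaired ⟨ [ user a ] , [] , d ⟩
        stored  : ∀ {d} → Unpaired ⟨ [] , [ a ] , d ⟩

      -- `pair` needs two atoms where at most one is stored, and `loop` puts its atom back.
      Unpaired-step : ∀ {V γ γ′} → Unpaired γ → Step P V γ γ′ → Unpaired γ′
      Unpaired-step pending (solve c p _)   with () ← ↭-singleton-inv (↭-sym p)
      Unpaired-step pending (introduce h p) with refl ← ↭-singleton-inv (↭-sym p) = stored
      Unpaired-step pending (simplify _ _ _ p (_ ∷ _) _)  = ⊥-elim (¬x∷xs↭[] (↭-sym p))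
      Unpaired-step pending (propagate _ _ _ p (_ ∷ _) _) = ⊥-elim (¬x∷xs↭[] (↭-sym p))
      Unpaired-step stored (solve _ p _)   = ⊥-elim (¬x∷xs↭[] (↭-sym p))
      Unpaired-step stored (introduce _ p) = ⊥-elim (¬x∷xs↭[] (↭-sym p))
      Unpaired-step stored (simplify (there (here refl)) _ (_ , _ , refl , _) p (_ ∷ _ ∷ []) _)
        with () ← ↭-length p
      Unpaired-step stored (propagate (here refl) _ (_ , _ , refl , _) p (_ ∷ []) _)
        with refl ← ↭-singleton-inv (↭-sym p) = stored
      Unpaired-step stored (simplify (here refl) () _ _ _ _)
      Unpaired-step stored (propagate (there (here refl)) () _ _ _ _)

      Unpaired-⟶⋆ : ∀ {V V′ γ γ′} → Unpaired γ → P ⊢ (V , γ) ⟶⋆ (V′ , γ′) → Unpaired γ′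
      Unpaired-⟶⋆ u ε            = u
      Unpaired-⟶⋆ u (step s ◅ t) = Unpaired-⟶⋆ (Unpaired-step u s) t

      no-final : ∀ {K d} → ¬ FinalConfig P [ user a ] K d
      no-final (V , t , stuck) with stored {d} ← Unpaired-⟶⋆ pending t =
        -- `loop` fires under any built-in store: its condition equates `a` with itself and so holds
        -- in every structure.
        stuck _ (step (propagate (here refl) refl (loop-fresh V) ↭-refl (~-refl a ∷ [])
          λ M _ v _ → ∃⋆-valid M (fvᵃˢ [ a ]) _ (λ v → (equationᵃ-refl a M v , tt) , tt) v))

      -- The built-in store left once `pair` has fired on two copies of `a`.
      answer : BuiltIn
      answer = equations (~-refl a ∷ ~-refl a ∷ []) ∧ true

      answer-valid : CT ⊨ ⌈ answer ⌉
      answer-valid M _ v = (equationᵃ-refl a M v , equationᵃ-refl a M v , tt) , tt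

      pair-final : FinalConfig P (user a ∷ user a ∷ []) [] answer
      pair-final = _ ,
        step (introduce a ↭-refl) ◅
        step (introduce a ↭-refl) ◅
        step (simplify (there (here refl)) refl (pair-fresh _) ↭-refl (~-refl a ∷ ~-refl a ∷ [])
          λ M mod v _ → ∃⋆-valid M (fvᵃˢ (a ∷ a ∷ [])) _
            (λ v → proj₁ (answer-valid M mod v) , tt) v) ◅ ε ,
        empty-̸⟶ P

    -- Contradiction with an acceptable encoding

    module _ {Π Π′ : Vocabulary} (a : Atom Π) (fv-a : fvᵃ a ≡ [])
      (rename-a : ∀ ρ → renameᵃ ρ a ≡ a)
      {ℓ} {𝒢 : Pred (Goals (CHR Π)) ℓ} (subheads : ContainsSubheads (CHR Π) 𝒢) where
      open Pairing a fv-a rename-a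

      -- Both test goals are in the class as submultisets of the head of `pair`.
      𝒢-single : 𝒢 [ user a ]
      𝒢-single = subheads pair _ [ a ] [ a ] ↭-refl

      𝒢-pair : 𝒢 (user a ∷ user a ∷ [])
      𝒢-pair = subheads pair _ (a ∷ a ∷ []) [] ↭-refl

      P₀ : Program (CHR Π)
      P₀ = P , _ ∷ _ ∷ []

      module _ (E : AcceptableEncoding (CHR Π) (CHR₁ Π′) 𝒢) where
        open AcceptableEncoding E

        no-encoding : ⊥
        no-encoding
          with _ , (d , final , refl) , eq ← proj₁ (SA-preserved P₀ _ 𝒢-pair) _ (answer , pair-final , refl)
          -- The answer to `a, a` is valid, hence so is its equivalent on the translated side, which
          -- makes `d` solvable for all values of the goal variables.
          with d₁ , final₁ ← final-empty-part (proj₂ ⟦ P₀ ⟧) (⟦⟧ᵍ-++ [ user a ] [ user a ]) final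
                 (valid⇒solvable _ d λ M mod v → proj₁ (eq M mod v)
                   (∃⋆-valid M (fvᵇ answer ∖ fvᵍ (user a ∷ user a ∷ [])) answer (answer-valid M mod) v))
          -- Preservation carries the answer of the translated `a` back to `a` itself, which has
          -- none.
          with _ , (_ , final₀ , _) , _ ← proj₂ (SA-preserved P₀ _ 𝒢-single) _ (d₁ , final₁ , refl) =
          no-final final₀

      module _ (E : AcceptableEncodingQA (CHR Π) (CHR₁ Π′) 𝒢) where
        open AcceptableEncodingQA E

        private
          G₁ G₂ : Goal Π′
          G₁ = ⟦ [ user a ] ⟧ᵍ
          G₂ = ⟦ user a ∷ user a ∷ [] ⟧ᵍ

          single : All SingleHeaded (proj₁ ⟦ P₀ ⟧)
          single = proj₂ ⟦ P₀ ⟧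

          splits : G₂ ↭ G₁ ++ G₁
          splits = ⟦⟧ᵍ-++ [ user a ] [ user a ]

          no-final₁ : ∀ {K₁ d₁} → ¬ FinalConfig (proj₁ ⟦ P₀ ⟧) G₁ K₁ d₁
          no-final₁ final₁
            with _ , (_ , _ , final₀ , _) , _ ← proj₂ (QA-preserved P₀ _ 𝒢-single) _ (_ , _ , final₁ , refl) =
            no-final final₀

        -- Whether `CT` has a model is never decided: each model is refuted first, and what remains
        -- is the inconsistent case.
        no-encodingQA : ⊥
        no-encodingQA
          with _ , (K , d , final , refl) , eq ←
            proj₁ (QA-preserved P₀ _ 𝒢-pair) _ ([] , answer , pair-final , refl) =
          let _ , _ , final₁ = final-part-inconsistent single splits no-model final in no-final₁ final₁
          where
          -- The answer to `a, a` denotes the empty multiset under every `v`, so the equivalent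
          -- answer of the translation must denote it too.
          denotes : ∀ M → IsModel CT M → (v : Assignment M) → ¬ ¬ (∃ λ w →
            AgreeOff M ((fvᵃˢ K ++ fvᵇ d) ∖ fvᵍ G₂) v w × Satᵇ M w d ×
            Permutation (_≈ᵃ_ M) [] (map (ground M w) K))
          denotes M mod v = proj₁ (eq M mod v) v (λ _ _ → refl) (answer-valid M mod v)

          solvable : Solvable (fvᵍ G₂) d
          solvable M mod v k = denotes M mod v λ (w , off , p , _) →
            k (w , AgreeOff-∖ M (fvᵃˢ K ++ fvᵇ d) (fvᵍ G₂) {v} {w} off , p)

          -- In a model of CT the answer has no user-defined atoms, so the
          -- store is empty and the answer is a data sufficient one.
          no-model : ∀ M → ¬ IsModel CT M
          no-model M mod = denotes M mod (λ _ → Structure.point M) λ (w , _ , _ , perm) →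
            let K≡[] = map-[]⁻ K (Permutation-empty-inv perm)
                _ , final₁ = final-empty-part single splits
                  (subst (λ K → FinalConfig (proj₁ ⟦ P₀ ⟧) G₂ K d) K≡[] final) solvable
            in no-final₁ final₁
            where
            map-[]⁻ : ∀ {A B : Set} {f : A → B} xs → map f xs ≡ [] → xs ≡ []
            map-[]⁻ [] _ = refl

  -- A closed atom, and the theorem

  closed-constant : (f : Fun) → arity f ≡ 0 → ∃ λ t → fvᵗ t ≡ []
  closed-constant f f-const = fun f (subst (Vec Term) (≡.sym f-const) []) , fvᵗˢ-[] f-const
    where
    -- The arity is generalised to a variable so that the equation can be matched on.
    fvᵗˢ-[] : ∀ {n} (e : n ≡ 0) → fvᵗˢ (subst (Vec Term) (≡.sym e) []) ≡ []
    fvᵗˢ-[] refl = refl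

open Signature using (arity; arityᵘ)
open Logic using (Theory; Vocabulary; Symbol; name; Goals; CHR; CHR₁; ContainsSubheads; _$_)
open Logic.Semantics using (AcceptableEncoding; AcceptableEncodingQA)

corollary4p7 : (Sg : Signature) (CT : Theory Sg) →
    (∃ λ f → arity Sg f ≡ 0) →
    (∃ λ f → arity Sg f > 0) →
    (Π Π′ : Vocabulary Sg) → Symbol Π →
    ∀ {ℓ} (𝒢 : Pred (Goals Sg (CHR Sg Π)) ℓ) → ContainsSubheads Sg (CHR Sg Π) 𝒢 →
    ¬ AcceptableEncoding Sg CT (CHR Sg Π) (CHR₁ Sg Π′) 𝒢 ×
    ¬ AcceptableEncodingQA Sg CT (CHR Sg Π) (CHR₁ Sg Π′) 𝒢
corollary4p7 Sg CT (f , f-const) _ Π Π′ p 𝒢 subheads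
  with t , fv-t ← closed-constant Sg f f-const =
  no-encoding Sg CT (p $ ts) fv-ts rename-ts subheads ,
  no-encodingQA Sg CT (p $ ts) fv-ts rename-ts subheads
  where
  n = arityᵘ Sg (name Π p)
  -- Filling every argument place with the same closed term makes the atom closed.
  ts = Vec.replicate n t
  fv-ts = fvᵗˢ-replicate Sg n {t} fv-t
  rename-ts = λ ρ → cong (p $_) (rename-closedᵗˢ Sg ρ ts fv-ts)
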